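{- Let $H$ be a tournament with the strong EH-property. Then $H$ admits a numbering for which the backedge graph is a forest.
   Context: All graphs and digraphs are finite, with no loops or parallel edges. A tournament is a digraph such that for every pair $u,v$ of distinct vertices exactly one of $uv,vu$ is an edge; an edge $uv$ is directed from $u$ to $v$. A tournament $G$ contains a tournament $H$ if some subtournament of $G$ is isomorphic to $H$; otherwise $G$ is $H$-free. $|G|$ denotes the number of vertices. A pure pair in a tournament $G$ is an ordered pair $(A,B)$ of disjoint subsets of $V(G)$ such that every vertex in $B$ is adjacent from every vertex in $A$ (i.e. $ab\in E(G)$ for all $a\in A,b\in B$); its order is $\min(|A|,|B|)$. A tournament $H$ has the strong EH-property if there exists $c>0$ such that for every $H$-free tournament $G$ with $|G|>1$, there is a pure pair in $G$ of order at least $c|G|$. A numbering of $H$ is an enumeration $(v_1,\dots,v_n)$ of $V(H)$. The corresponding backedge graph is the (undirected, ordered) graph $B$ with vertex set $V(H)$ in which, for $1\le i<j\le n$, $v_i,v_j$ are adjacent in $B$ if and only if $v_jv_i\in E(H)$ (that is, $v_i$ is adjacent from $v_j$ in $H$). -}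

module Defs where

open import Data.Fin using (Fin; zero; suc; inject₁; fromℕ; _<_)
open import Data.Fin.Permutation using (Permutation′; _⟨$⟩ˡ_)
open import Data.Fin.Properties using (<-irrefl)
open import Data.Fin.Subset using (Subset; _∈_; _∩_; ∣_∣; Empty)
open import Data.Integer using (+_)
open import Data.Nat as ℕ using (ℕ; _⊓_)
open import Data.Product using (Σ; ∃; _×_; _,_; proj₁; proj₂)
open import Data.Rational as ℚ using (ℚ; 0ℚ; _/_)
open import Data.Sum using (_⊎_; inj₁; inj₂; swap)
open import Function.Bundles using (_↔_; _⇔_; Inverse)
open import Function.Definitions using (Injective)
open import Level using (0ℓ)
open import Relation.Binary.Core using (Rel)
open import Relation.Binary.Definitions using (Trichotomous; Symmetric)
open import Relation.Binary.PropositionalEquality using (_≡_; refl)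
open import Relation.Nullary using (¬_)

-- Trichotomy: for all u, v exactly one of u ⟶ v, u ≡ v, v ⟶ u holds.  The
-- case u ≡ v excludes loops; for distinct u, v exactly one of uv, vu is an edge.
record Tournament (n : ℕ) : Set₁ where
  field
    _⟶_     : Rel (Fin n) 0ℓ
    compare : Trichotomous _≡_ _⟶_

record Graph (n : ℕ) : Set₁ where
  field
    Adj        : Rel (Fin n) 0ℓ
    symmetric  : Symmetric Adj
    loopless   : ∀ u → ¬ Adj u u

-- Subtournaments are the induced subdigraphs G[X], X ⊆ V(G), so a copy of H is
-- a bijection from V(H) to X that preserves and reflects edges.
Contains : ∀ {m n} → Tournament n → Tournament m → Set
Contains {m} {n} G H =
  Σ (Subset n) λ X →
  Σ (Fin m ↔ Σ (Fin n) (_∈ X)) λ φ →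
  let f = λ u → proj₁ (Inverse.to φ u) in
  ∀ u v → (u H.⟶ v) ⇔ (f u G.⟶ f v)
  where
  module G = Tournament G
  module H = Tournament H

_isFreeOf_ : ∀ {m n} → Tournament n → Tournament m → Set
G isFreeOf H = ¬ Contains G H

record PurePair {n} (G : Tournament n) : Set where
  open Tournament G
  field
    A B      : Subset n
    disjoint : Empty (A ∩ B)
    pure     : ∀ {a b} → a ∈ A → b ∈ B → a ⟶ b

  order : ℕ
  order = ∣ A ∣ ⊓ ∣ B ∣

-- Taking c rational loses nothing: if a real c > 0 works, so does every
-- rational c′ with 0 < c′ ≤ c.
StrongEH : ∀ {m} → Tournament m → Set₁
StrongEH H =
  Σ ℚ λ c → 0ℚ ℚ.< c ×
  (∀ {n} (G : Tournament n) → G isFreeOf H → 1 ℕ.< n →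
   Σ (PurePair G) λ P → c ℚ.* (+ n / 1) ℚ.≤ + PurePair.order P / 1)

-- σ ⟨$⟩ʳ i is the vertex vᵢ; σ ⟨$⟩ˡ v is the index of the vertex v.
Numbering : ∀ {n} → Tournament n → Set
Numbering {n} _ = Permutation′ n

backedgeGraph : ∀ {n} (H : Tournament n) → Numbering H → Graph n
backedgeGraph H σ = record
  { Adj       = λ u v → Back u v ⊎ Back v u
  ; symmetric = swap
  ; loopless  = λ { u (inj₁ (u<u , _)) → <-irrefl refl u<u
                  ; u (inj₂ (u<u , _)) → <-irrefl refl u<u }
  }
  where
  open Tournament H
  Back : Rel _ 0ℓ
  Back u v = (σ ⟨$⟩ˡ u) < (σ ⟨$⟩ˡ v) × v ⟶ u

-- A cycle with vertices c₀, …, c_k in cyclic order, of length k + 1 ≥ 3.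
record Cycle {n} (B : Graph n) : Set where
  open Graph B
  field
    k        : ℕ
    2≤k      : 2 ℕ.≤ k
    c        : Fin (ℕ.suc k) → Fin n
    distinct : Injective _≡_ _≡_ c
    adjacent : ∀ (i : Fin k) → Adj (c (inject₁ i)) (c (suc i))
    closing  : Adj (c (fromℕ k)) (c zero)

IsForest : ∀ {n} → Graph n → Set
IsForest B = ¬ Cycle B

{-# OPTIONS --safe #-}
module Submission where

open import Data.Bool.Base using (true; false)
open import Data.Empty using (⊥; ⊥-elim)
open import Data.Fin as Fin using (Fin; zero; suc; toℕ; inject₁; fromℕ)
open import Data.Fin.Permutation using (Permutation′; permutation; _⟨$⟩ˡ_)
import Data.Fin.Properties as Finₚ
open import Data.Fin.Subset using (Subset; ∣_∣) renaming (_∈_ to _∈ˢ_)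
open import Data.Fin.Subset.Properties using (drop-there) renaming (_∈?_ to _∈ˢ?_)
open import Data.Integer as ℤ using (-[1+_]; +<+)
import Data.Integer.Properties as ℤₚ
open import Data.List using (List; []; _∷_; _++_; map; length; allFin; concatMap; cartesianProduct; tabulate)
import Data.List.Membership.DecPropositional as DecMembership
open import Data.List.Membership.Propositional using (_∈_; _∉_; lose)
open import Data.List.Membership.Propositional.Properties using (∈-allFin; ∈-++⁺ˡ; ∈-++⁺ʳ; ∈-map⁺; ∈-concatMap⁺; ∈-cartesianProduct⁺)
open import Data.List.Properties using (length-tabulate; length-++; length-map)
open import Data.List.Relation.Unary.All using (All; []; _∷_)
open import Data.List.Relation.Unary.AllPairs using ([]; _∷_)
open import Data.List.Relation.Unary.Any using (here; there)
open import Data.List.Relation.Unary.Unique.Propositional using (Unique)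
open import Data.List.Relation.Unary.Unique.Propositional.Properties using (allFin⁺)
open import Data.Nat
open import Data.Nat.ListAction using (sum)
open import Data.Nat.Properties
open import Data.Nat.Tactic.RingSolver using (solve-∀)
open import Data.Product using (Σ; ∃; _×_; _,_; proj₁; proj₂)
open import Data.Rational as ℚ using (mkℚ; 0ℚ)
import Data.Rational.Properties as ℚₚ
open import Data.Rational.Unnormalised as ℚᵘ using (mkℚᵘ)
import Data.Rational.Unnormalised.Properties as ℚᵘₚ
open import Data.Sum using (_⊎_; inj₁; inj₂)
open import Data.Unit using (tt)
open import Data.Vec as Vec using (Vec; []; _∷_; there)
import Data.Vec.Properties as Vecₚ
open import Function using (_∘_; id; it)
open import Function.Bundles using (Inverse; Equivalence)
open import Function.Definitions using (Injective)
open import Relation.Binary.Definitions using (Tri; tri<; tri≈; tri>)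
open import Relation.Binary.PropositionalEquality
open import Relation.Nullary using (¬_; Dec; yes; no; contradiction; ¬?; _×-dec_; _→-dec_; does)
open import Relation.Nullary.Decidable using (dec-true; map′)
open import Defs

-- Sparse graphs of large girth are used as backedge graphs of a tournament G on n vertices.  If G
-- contains H, then listing V(H) in the order of G gives a backedge graph without cycles of length
-- at most |H|, that is, a forest.  Otherwise the strong EH-property gives a pure pair of linear
-- order; cutting it at a vertex gives two linear sets with either no edges between them or all of
-- them, and the latter contains a 4-cycle.
--
-- The graph, in which any two sets of size n / K (up to a constant) are joined by an edge, is built
-- greedily.  While at most C n edges are present and the maximum degree is at most D, few vertices
-- have degree D and few vertices are close to a given one, so by averaging some edge between
-- distant vertices of degree less than D joins a proportion 1 / K² of the still unjoined pairs of
-- sets.  There are at most 4 ^ n pairs, so C n steps suffice, where C depends only on K.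

-- Sums and counting

∑ : ∀ {A : Set} → List A → (A → ℕ) → ℕ
∑ []       f = 0
∑ (x ∷ xs) f = f x + ∑ xs f

∑-mono : ∀ {A : Set} (xs : List A) {f g : A → ℕ} → (∀ x → f x ≤ g x) → ∑ xs f ≤ ∑ xs g
∑-mono []       f≤g = z≤n
∑-mono (x ∷ xs) f≤g = +-mono-≤ (f≤g x) (∑-mono xs f≤g)

∑-cong : ∀ {A : Set} (xs : List A) {f g : A → ℕ} → (∀ x → f x ≡ g x) → ∑ xs f ≡ ∑ xs g
∑-cong []       f≡g = refl
∑-cong (x ∷ xs) f≡g = cong₂ _+_ (f≡g x) (∑-cong xs f≡g)

∑-+ : ∀ {A : Set} (xs : List A) (f g : A → ℕ) → ∑ xs (λ x → f x + g x) ≡ ∑ xs f + ∑ xs g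
∑-+ []       f g = refl
∑-+ (x ∷ xs) f g rewrite ∑-+ xs f g = interchange (f x) (g x) (∑ xs f) (∑ xs g)
  where
  interchange : ∀ a b c d → a + b + (c + d) ≡ a + c + (b + d)
  interchange = solve-∀

∑-const : ∀ {A : Set} (xs : List A) c → ∑ xs (λ _ → c) ≡ length xs * c
∑-const []       c = refl
∑-const (x ∷ xs) c = cong (c +_) (∑-const xs c)

∑-*ʳ : ∀ {A : Set} (xs : List A) (f : A → ℕ) c → ∑ xs (λ x → f x * c) ≡ ∑ xs f * c
∑-*ʳ []       f c = refl
∑-*ʳ (x ∷ xs) f c rewrite ∑-*ʳ xs f c = sym (*-distribʳ-+ c (f x) (∑ xs f))

∑-swap : ∀ {A B : Set} (xs : List A) (ys : List B) (f : A → B → ℕ) →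
         ∑ xs (λ x → ∑ ys (f x)) ≡ ∑ ys (λ y → ∑ xs (λ x → f x y))
∑-swap []       ys f = sym (trans (∑-const ys 0) (*-zeroʳ (length ys)))
∑-swap (x ∷ xs) ys f rewrite ∑-swap xs ys f = sym (∑-+ ys (f x) (λ y → ∑ xs (λ x → f x y)))

∈⇒≤∑ : ∀ {A : Set} {xs : List A} {x} (f : A → ℕ) → x ∈ xs → f x ≤ ∑ xs f
∈⇒≤∑ {xs = _ ∷ xs} f (here refl) = m≤m+n _ (∑ xs f)
∈⇒≤∑ {xs = y ∷ _}  f (there x∈)  = ≤-trans (∈⇒≤∑ f x∈) (m≤n+m _ (f y))

-- The averaging principle in a form without division. `x₀` is the witness for the empty list.
∑-max : ∀ {A : Set} (x₀ : A) (xs : List A) (f : A → ℕ) → ∃ λ x → ∑ xs f ≤ length xs * f x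
∑-max x₀ []       f = x₀ , z≤n
∑-max x₀ (y ∷ ys) f with ∑-max x₀ ys f
... | x , ≤x with ≤-total (f x) (f y)
...   | inj₁ fx≤fy = y , +-monoʳ-≤ (f y) (≤-trans ≤x (*-monoʳ-≤ (length ys) fx≤fy))
...   | inj₂ fy≤fx = x , +-mono-≤ fy≤fx ≤x

∑-positive : ∀ {A : Set} (xs : List A) (f : A → ℕ) → 0 < ∑ xs f → ∃ λ x → 0 < f x
∑-positive (x ∷ xs) f 0<∑ with f x in eq
... | zero  = ∑-positive xs f 0<∑
... | suc _ = x , subst (0 <_) (sym eq) z<s

𝟙 : ∀ {P : Set} → Dec P → ℕ
𝟙 (yes _) = 1
𝟙 (no _)  = 0

𝟙-true : ∀ {P : Set} (P? : Dec P) → P → 𝟙 P? ≡ 1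
𝟙-true (yes _) p = refl
𝟙-true (no ¬p) p = contradiction p ¬p

𝟙-false : ∀ {P : Set} (P? : Dec P) → ¬ P → 𝟙 P? ≡ 0
𝟙-false (yes p) ¬p = contradiction p ¬p
𝟙-false (no _)  ¬p = refl

𝟙-positive : ∀ {P : Set} (P? : Dec P) → 0 < 𝟙 P? → P
𝟙-positive (yes p) _ = p

𝟙≤1 : ∀ {P : Set} (P? : Dec P) → 𝟙 P? ≤ 1
𝟙≤1 (yes _) = ≤-refl
𝟙≤1 (no _)  = z≤n

𝟙-mono : ∀ {P Q : Set} (P? : Dec P) (Q? : Dec Q) → (P → Q) → 𝟙 P? ≤ 𝟙 Q?
𝟙-mono (yes p) Q? P⇒Q = ≤-reflexive (sym (𝟙-true Q? (P⇒Q p)))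
𝟙-mono (no _)  Q? P⇒Q = z≤n

𝟙-cong : ∀ {P Q : Set} (P? : Dec P) (Q? : Dec Q) → (P → Q) → (Q → P) → 𝟙 P? ≡ 𝟙 Q?
𝟙-cong P? Q? P⇒Q Q⇒P = ≤-antisym (𝟙-mono P? Q? P⇒Q) (𝟙-mono Q? P? Q⇒P)

𝟙-cover : ∀ {P Q R : Set} (P? : Dec P) (Q? : Dec Q) (R? : Dec R) →
          (P → Q ⊎ R) → 𝟙 P? ≤ 𝟙 Q? + 𝟙 R?
𝟙-cover (no _)  Q? R? P⇒ = z≤n
𝟙-cover (yes p) Q? R? P⇒ with P⇒ p
... | inj₁ q = ≤-trans (≤-reflexive (sym (𝟙-true Q? q))) (m≤m+n _ _)
... | inj₂ r = ≤-trans (≤-reflexive (sym (𝟙-true R? r))) (m≤n+m _ (𝟙 Q?))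

𝟙-disjoint : ∀ {P Q R : Set} (P? : Dec P) (Q? : Dec Q) (R? : Dec R) →
             (P → R) → (Q → R) → (P → Q → ⊥) → 𝟙 P? + 𝟙 Q? ≤ 𝟙 R?
𝟙-disjoint (yes p) (yes q) R? P⇒R Q⇒R ¬PQ = contradiction q (¬PQ p)
𝟙-disjoint (yes p) (no _)  R? P⇒R Q⇒R ¬PQ = ≤-reflexive (sym (𝟙-true R? (P⇒R p)))
𝟙-disjoint (no _)  Q?      R? P⇒R Q⇒R ¬PQ = 𝟙-mono Q? R? Q⇒R

# : ∀ {n} {P : Fin n → Set} → (∀ x → Dec (P x)) → ℕ
# {n} P? = ∑ (allFin n) (𝟙 ∘ P?)

#-mono : ∀ {n} {P Q : Fin n → Set} (P? : ∀ x → Dec (P x)) (Q? : ∀ x → Dec (Q x)) →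
         (∀ x → P x → Q x) → # P? ≤ # Q?
#-mono {n} P? Q? P⇒Q = ∑-mono (allFin n) λ x → 𝟙-mono (P? x) (Q? x) (P⇒Q x)

#-cover : ∀ {n} {P Q R : Fin n → Set} (P? : ∀ x → Dec (P x)) (Q? : ∀ x → Dec (Q x))
          (R? : ∀ x → Dec (R x)) → (∀ x → P x → Q x ⊎ R x) → # P? ≤ # Q? + # R?
#-cover {n} P? Q? R? P⇒ = ≤-trans
  (∑-mono (allFin n) λ x → 𝟙-cover (P? x) (Q? x) (R? x) (P⇒ x))
  (≤-reflexive (∑-+ (allFin n) _ _))

#-disjoint : ∀ {n} {P Q R : Fin n → Set} (P? : ∀ x → Dec (P x)) (Q? : ∀ x → Dec (Q x))
             (R? : ∀ x → Dec (R x)) → (∀ x → P x → R x) → (∀ x → Q x → R x) →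
             (∀ x → P x → ¬ Q x) → # P? + # Q? ≤ # R?
#-disjoint {n} P? Q? R? P⇒R Q⇒R ¬PQ = ≤-trans
  (≤-reflexive (sym (∑-+ (allFin n) _ _)))
  (∑-mono (allFin n) λ x → 𝟙-disjoint (P? x) (Q? x) (R? x) (P⇒R x) (Q⇒R x) (¬PQ x))

#-positive : ∀ {n} {P : Fin n → Set} (P? : ∀ x → Dec (P x)) → 0 < # P? → ∃ P
#-positive {n} P? 0<# with ∑-positive (allFin n) (𝟙 ∘ P?) 0<#
... | x , 0<𝟙 = x , 𝟙-positive (P? x) 0<𝟙

∃⇒#-positive : ∀ {n} {P : Fin n → Set} (P? : ∀ x → Dec (P x)) → ∃ P → 0 < # P?
∃⇒#-positive P? (x , p) =
  ≤-trans (≤-reflexive (sym (𝟙-true (P? x) p))) (∈⇒≤∑ (𝟙 ∘ P?) (∈-allFin x))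

#≤n : ∀ {n} {P : Fin n → Set} (P? : ∀ x → Dec (P x)) → # P? ≤ n
#≤n {n} P? = begin
  # P?                        ≤⟨ ∑-mono (allFin n) (𝟙≤1 ∘ P?) ⟩
  ∑ (allFin n) (λ _ → 1)      ≡⟨ ∑-const (allFin n) 1 ⟩
  length (allFin n) * 1       ≡⟨ *-identityʳ _ ⟩
  length (allFin n)           ≡⟨ length-tabulate id ⟩
  n                           ∎
  where open ≤-Reasoning

-- `allFin n` has no repeated entries, so once one entry satisfies `P` all later ones contribute 0.
#-subsingleton : ∀ {n} {P : Fin n → Set} (P? : ∀ x → Dec (P x)) →
                 (∀ x y → P x → P y → x ≡ y) → # P? ≤ 1
#-subsingleton {n} {P} P? unique = go (allFin n) (allFin⁺ n)
  where
  none : ∀ {x} xs → P x → All (λ y → ¬ x ≡ y) xs → ∑ xs (𝟙 ∘ P?) ≡ 0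
  none []       px []           = refl
  none (y ∷ xs) px (x≢y ∷ rest) =
    cong₂ _+_ (𝟙-false (P? y) λ py → x≢y (unique _ _ px py)) (none xs px rest)

  go : ∀ xs → Unique xs → ∑ xs (𝟙 ∘ P?) ≤ 1
  go []       []       = z≤n
  go (x ∷ xs) (x∉ ∷ u) with P? x
  ... | yes px = ≤-reflexive (cong suc (none xs px x∉))
  ... | no _   = go xs u

#-two : ∀ {n} {P : Fin n → Set} (P? : ∀ x → Dec (P x)) → 2 ≤ # P? →
        ∃ λ x → ∃ λ y → x ≢ y × P x × P y
#-two P? 2≤# with #-positive P? (≤-trans (s≤s z≤n) 2≤#)
... | x , px with #-positive (λ y → ¬? (x Finₚ.≟ y) ×-dec P? y) 0<
  where
  0< : 0 < # (λ y → ¬? (x Finₚ.≟ y) ×-dec P? y)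
  0< = +-cancelˡ-≤ 1 _ _ (≤-trans 2≤# (≤-trans
    (#-cover P? (x Finₚ.≟_) (λ y → ¬? (x Finₚ.≟ y) ×-dec P? y) cover)
    (+-monoˡ-≤ _ (#-subsingleton (x Finₚ.≟_) λ _ _ x≡y x≡z → trans (sym x≡y) x≡z))))
    where
    cover : ∀ y → _ → x ≡ y ⊎ (x ≢ y × _)
    cover y py with x Finₚ.≟ y
    ... | yes x≡y = inj₁ x≡y
    ... | no x≢y  = inj₂ (x≢y , py)
...   | y , x≢y , py = x , y , x≢y , px , py

infix 4 _∈?_
_∈?_ : ∀ {n} (x : Fin n) (l : List (Fin n)) → Dec (x ∈ l)
_∈?_ = DecMembership._∈?_ Finₚ._≟_

#-∈-list : ∀ {n} (l : List (Fin n)) (∈l? : ∀ x → Dec (x ∈ l)) → # ∈l? ≤ length l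
#-∈-list {n} [] ∈l? = ≤-reflexive (trans
  (∑-cong (allFin n) λ x → 𝟙-false (∈l? x) λ ())
  (trans (∑-const (allFin n) 0) (*-zeroʳ (length (allFin n)))))
#-∈-list (x ∷ l) ∈l? = ≤-trans
  (#-cover ∈l? (Finₚ._≟ x) (_∈? l) λ { _ (here eq) → inj₁ eq ; _ (there y∈) → inj₂ y∈ })
  (+-mono-≤ (#-subsingleton (Finₚ._≟ x) λ _ _ y≡x z≡x → trans y≡x (sym z≡x))
            (#-∈-list l (_∈? l)))

∑-tabulate : ∀ {n} {A : Set} (g : Fin n → A) (f : A → ℕ) →
             ∑ (tabulate g) f ≡ sum (tabulate (f ∘ g))
∑-tabulate {zero}  g f = refl
∑-tabulate {suc n} g f = cong (f (g zero) +_) (∑-tabulate (g ∘ suc) f)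

∑-allFin-suc : ∀ {n} (f : Fin (suc n) → ℕ) →
               ∑ (allFin (suc n)) f ≡ f zero + ∑ (allFin n) (f ∘ suc)
∑-allFin-suc f = cong (f zero +_)
  (trans (∑-tabulate suc f) (sym (∑-tabulate id (f ∘ suc))))

-- Subsets and their enumeration

∣∣≡# : ∀ {n} (A : Subset n) → ∣ A ∣ ≡ # (_∈ˢ? A)
∣∣≡# []      = refl
∣∣≡# {suc n} (b ∷ A) = trans (head+tail b) (sym (∑-allFin-suc (𝟙 ∘ (_∈ˢ? (b ∷ A)))))
  where
  ∈-tail : ∀ b → # (_∈ˢ? A) ≡ ∑ (allFin n) (λ x → 𝟙 (suc x ∈ˢ? (b ∷ A)))
  ∈-tail b = ∑-cong (allFin n) λ x →
    𝟙-cong (x ∈ˢ? A) (suc x ∈ˢ? (b ∷ A)) there drop-there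

  head+tail : ∀ b → ∣ b ∷ A ∣ ≡
              𝟙 (zero ∈ˢ? (b ∷ A)) + ∑ (allFin n) (λ x → 𝟙 (suc x ∈ˢ? (b ∷ A)))
  head+tail true  = cong suc (trans (∣∣≡# A) (∈-tail true))
  head+tail false = trans (∣∣≡# A) (∈-tail false)

subset : ∀ {n} {P : Fin n → Set} → (∀ x → Dec (P x)) → Subset n
subset P? = Vec.tabulate (λ x → does (P? x))

∈-subset⁺ : ∀ {n} {P : Fin n → Set} (P? : ∀ x → Dec (P x)) {x} → P x → x ∈ˢ subset P?
∈-subset⁺ P? {x} p =
  Vecₚ.lookup⇒[]= x _ (trans (Vecₚ.lookup∘tabulate _ x) (dec-true (P? x) p))

∈-subset⁻ : ∀ {n} {P : Fin n → Set} (P? : ∀ x → Dec (P x)) {x} → x ∈ˢ subset P? → P x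
∈-subset⁻ P? {x} x∈ with P? x in eq
... | yes p = p
... | no _  = contradiction
  (trans (sym (Vecₚ.[]=⇒lookup x∈)) (trans (Vecₚ.lookup∘tabulate _ x) (cong does eq))) λ ()

subsets : ∀ n → List (Subset n)
subsets zero    = [] ∷ []
subsets (suc n) = map (true ∷_) (subsets n) ++ map (false ∷_) (subsets n)

∈-subsets : ∀ {n} (A : Subset n) → A ∈ subsets n
∈-subsets []          = here refl
∈-subsets (true ∷ A)  = ∈-++⁺ˡ (∈-map⁺ (true ∷_) (∈-subsets A))
∈-subsets (false ∷ A) = ∈-++⁺ʳ _ (∈-map⁺ (false ∷_) (∈-subsets A))

length-subsets : ∀ n → length (subsets n) ≡ 2 ^ n
length-subsets zero    = refl
length-subsets (suc n) = begin
  length (map (true ∷_) (subsets n) ++ map (false ∷_) (subsets n))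
    ≡⟨ length-++ (map (true ∷_) (subsets n)) ⟩
  length (map (true ∷_) (subsets n)) + length (map (false ∷_) (subsets n))
    ≡⟨ cong₂ _+_ (length-map (true ∷_) (subsets n)) (length-map (false ∷_) (subsets n)) ⟩
  length (subsets n) + length (subsets n)
    ≡⟨ cong₂ _+_ (length-subsets n) (trans (length-subsets n) (sym (+-identityʳ _))) ⟩
  2 ^ suc n ∎
  where open ≡-Reasoning

length-cartesianProduct : ∀ {A B : Set} (xs : List A) (ys : List B) →
                          length (cartesianProduct xs ys) ≡ length xs * length ys
length-cartesianProduct []       ys = refl
length-cartesianProduct (x ∷ xs) ys = trans (length-++ (map (x ,_) ys))
  (cong₂ _+_ (length-map (x ,_) ys) (length-cartesianProduct xs ys))

abstract
  subsetPairs : ∀ n → List (Subset n × Subset n)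
  subsetPairs n = cartesianProduct (subsets n) (subsets n)

  length-subsetPairs : ∀ n → length (subsetPairs n) ≡ 4 ^ n
  length-subsetPairs n = begin
    length (subsetPairs n)                   ≡⟨ length-cartesianProduct (subsets n) (subsets n) ⟩
    length (subsets n) * length (subsets n)  ≡⟨ cong₂ _*_ (length-subsets n) (length-subsets n) ⟩
    2 ^ n * 2 ^ n                            ≡⟨ sym (^-distribˡ-+-* 2 n n) ⟩
    2 ^ (n + n)                              ≡⟨ cong (λ k → 2 ^ (n + k)) (sym (+-identityʳ n)) ⟩
    2 ^ (2 * n)                              ≡⟨ sym (^-*-assoc 2 2 n) ⟩
    4 ^ n                                    ∎
    where open ≡-Reasoning

  ∈-subsetPairs : ∀ {n} (x : Subset n × Subset n) → x ∈ subsetPairs n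
  ∈-subsetPairs (A , B) = ∈-cartesianProduct⁺ (∈-subsets A) (∈-subsets B)

-- Graphs of large girth

-- Adjacency lists, so that degrees are lengths and balls can be computed; symmetry is imposed
-- separately by `Symm`.
Nbhd : ℕ → Set
Nbhd n = Fin n → List (Fin n)

-- The index is an upper bound for the length, since `stop` is allowed at every index. A walk of
-- index `l` thus expresses distance at most `l`.
data Walk {n} (R : Fin n → Fin n → Set) : ℕ → Fin n → Fin n → Set where
  stop : ∀ {l a} → Walk R l a a
  step : ∀ {l a b c} → R a b → Walk R l b c → Walk R (suc l) a c

Walk-map : ∀ {n} {R S : Fin n → Fin n → Set} → (∀ {a b} → R a b → S a b) →
           ∀ {l a b} → Walk R l a b → Walk S l a b
Walk-map R⇒S stop       = stop
Walk-map R⇒S (step r w) = step (R⇒S r) (Walk-map R⇒S w)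

Walk-weaken : ∀ {n} {R : Fin n → Fin n → Set} {l l′ a b} → l ≤ l′ → Walk R l a b → Walk R l′ a b
Walk-weaken l≤l′       stop       = stop
Walk-weaken (s≤s l≤l′) (step r w) = step r (Walk-weaken l≤l′ w)

Walk-++ : ∀ {n} {R : Fin n → Fin n → Set} {l l′ a b c} →
          Walk R l a b → Walk R l′ b c → Walk R (l + l′) a c
Walk-++ {l = l} stop w′ = Walk-weaken (m≤n+m _ l) w′
Walk-++ (step r w) w′   = step r (Walk-++ w w′)

Walk-reverse : ∀ {n} {R : Fin n → Fin n → Set} → (∀ {a b} → R a b → R b a) →
               ∀ {l a b} → Walk R l a b → Walk R l b a
Walk-reverse R-sym stop = stop
Walk-reverse {R = R} R-sym {suc l} {a} {c} (step r w) =
  subst (λ k → Walk R k c a) (+-comm l 1)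
    (Walk-++ (Walk-reverse R-sym w) (step (R-sym r) (stop {l = 0})))

ball : ∀ {n} → Nbhd n → ℕ → Fin n → List (Fin n)
ball N zero    u = u ∷ []
ball N (suc r) u = u ∷ concatMap (ball N r) (N u)

Walk⇒∈ball : ∀ {n} (N : Nbhd n) {r u v} → Walk (λ a b → b ∈ N a) r u v → v ∈ ball N r u
Walk⇒∈ball N {zero}  stop = here refl
Walk⇒∈ball N {suc r} stop = here refl
Walk⇒∈ball N (step b∈ w) = there (∈-concatMap⁺ (ball N _) (lose b∈ (Walk⇒∈ball N w)))

-- The geometric sum `1 + D + ... + D ^ r`, which bounds the size of a ball of radius `r` when all
-- degrees are at most `D`.
ballBound : ℕ → ℕ → ℕ
ballBound D zero    = 1
ballBound D (suc r) = suc (D * ballBound D r)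

length-concatMap-≤ : ∀ {A B : Set} (f : A → List B) xs b → (∀ x → length (f x) ≤ b) →
                     length (concatMap f xs) ≤ length xs * b
length-concatMap-≤ f []       b f≤b = z≤n
length-concatMap-≤ f (x ∷ xs) b f≤b = ≤-trans (≤-reflexive (length-++ (f x)))
  (+-mono-≤ (f≤b x) (length-concatMap-≤ f xs b f≤b))

length-ball : ∀ {n} (N : Nbhd n) D → (∀ u → length (N u) ≤ D) →
              ∀ r u → length (ball N r u) ≤ ballBound D r
length-ball N D N≤D zero    u = ≤-refl
length-ball N D N≤D (suc r) u = s≤s (≤-trans
  (length-concatMap-≤ (ball N r) (N u) (ballBound D r) (length-ball N D N≤D r))
  (*-monoˡ-≤ (ballBound D r) (N≤D u)))

Avoiding : ∀ {n} → Nbhd n → Fin n → Fin n → Fin n → Fin n → Set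
Avoiding N x y a b = b ∈ N a × ¬ (a ≡ x × b ≡ y) × ¬ (a ≡ y × b ≡ x)

-- No edge lies on a cycle of length at most g + 1.
LargeGirth : ∀ {n} → ℕ → Nbhd n → Set
LargeGirth g N = ∀ {x y} → y ∈ N x → ¬ Walk (Avoiding N x y) g x y

Symm : ∀ {n} → Nbhd n → Set
Symm N = ∀ {u v} → v ∈ N u → u ∈ N v

addArc : ∀ {n} → Fin n → Fin n → Nbhd n → Nbhd n
addArc u v N x with x Finₚ.≟ u
... | yes _ = v ∷ N x
... | no _  = N x

addEdge : ∀ {n} → Fin n → Fin n → Nbhd n → Nbhd n
addEdge u v N = addArc v u (addArc u v N)

addArc-new : ∀ {n} (u v : Fin n) N → v ∈ addArc u v N u
addArc-new u v N with u Finₚ.≟ u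
... | yes _  = here refl
... | no u≢u = contradiction refl u≢u

addArc-old : ∀ {n} (u v : Fin n) N x {y} → y ∈ N x → y ∈ addArc u v N x
addArc-old u v N x y∈ with x Finₚ.≟ u
... | yes _ = there y∈
... | no _  = y∈

addArc⁻ : ∀ {n} (u v : Fin n) N x {y} → y ∈ addArc u v N x → (x ≡ u × y ≡ v) ⊎ y ∈ N x
addArc⁻ u v N x y∈ with x Finₚ.≟ u
addArc⁻ u v N x (here y≡v) | yes x≡u = inj₁ (x≡u , y≡v)
addArc⁻ u v N x (there y∈) | yes _   = inj₂ y∈
addArc⁻ u v N x y∈         | no _    = inj₂ y∈

length-addArc : ∀ {n} (u v : Fin n) N x → length (addArc u v N x) ≡ 𝟙 (x Finₚ.≟ u) + length (N x)
length-addArc u v N x with x Finₚ.≟ u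
... | yes _ = refl
... | no _  = refl

addEdge-old : ∀ {n} (u v : Fin n) N x {y} → y ∈ N x → y ∈ addEdge u v N x
addEdge-old u v N x y∈ = addArc-old v u (addArc u v N) x (addArc-old u v N x y∈)

addEdge⁻ : ∀ {n} (u v : Fin n) N x {y} → y ∈ addEdge u v N x →
           y ∈ N x ⊎ (x ≡ u × y ≡ v) ⊎ (x ≡ v × y ≡ u)
addEdge⁻ u v N x y∈ with addArc⁻ v u (addArc u v N) x y∈
... | inj₁ vu = inj₂ (inj₂ vu)
... | inj₂ y∈′ with addArc⁻ u v N x y∈′
...   | inj₁ uv  = inj₂ (inj₁ uv)
...   | inj₂ y∈″ = inj₁ y∈″

addEdge-new : ∀ {n} (u v : Fin n) N → v ∈ addEdge u v N u
addEdge-new u v N = addArc-old v u (addArc u v N) u (addArc-new u v N)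

addEdge-Symm : ∀ {n} (u v : Fin n) N → Symm N → Symm (addEdge u v N)
addEdge-Symm u v N N-sym {x} y∈ with addEdge⁻ u v N x y∈
... | inj₁ y∈′                  = addEdge-old u v N _ (N-sym y∈′)
... | inj₂ (inj₁ (refl , refl)) = addArc-new v u (addArc u v N)
... | inj₂ (inj₂ (refl , refl)) = addEdge-new u v N

PlusEdge : ∀ {n} → (Fin n → Fin n → Set) → Fin n → Fin n → Fin n → Fin n → Set
PlusEdge R u v a b = R a b ⊎ (a ≡ u × b ≡ v) ⊎ (a ≡ v × b ≡ u)

-- A walk through the new edge may be cut before its first and after its last use of that edge;
-- if these uses have opposite directions, the part between them can be dropped.
Walk-PlusEdge : ∀ {n} {R : Fin n → Fin n → Set} {u v l a b} → Walk (PlusEdge R u v) l a b →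
  Walk R l a b ⊎
  (∃ λ i → ∃ λ j → suc (i + j) ≤ l ×
    ((Walk R i a u × Walk R j v b) ⊎ (Walk R i a v × Walk R j u b)))
Walk-PlusEdge stop = inj₁ stop
Walk-PlusEdge (step e w) with Walk-PlusEdge w
Walk-PlusEdge (step (inj₁ r) w) | inj₁ w′ = inj₁ (step r w′)
Walk-PlusEdge (step (inj₁ r) w) | inj₂ (i , j , i+j<l , inj₁ (w₁ , w₂)) =
  inj₂ (suc i , j , s≤s i+j<l , inj₁ (step r w₁ , w₂))
Walk-PlusEdge (step (inj₁ r) w) | inj₂ (i , j , i+j<l , inj₂ (w₁ , w₂)) =
  inj₂ (suc i , j , s≤s i+j<l , inj₂ (step r w₁ , w₂))
Walk-PlusEdge (step (inj₂ (inj₁ (refl , refl))) w) | inj₁ w′ =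
  inj₂ (0 , _ , ≤-refl , inj₁ (stop , w′))
Walk-PlusEdge (step (inj₂ (inj₁ (refl , refl))) w) | inj₂ (i , j , i+j<l , inj₁ (_ , w₂)) =
  inj₂ (0 , j , s≤s (≤-trans (m≤n+m j (suc i)) i+j<l) , inj₁ (stop , w₂))
Walk-PlusEdge (step (inj₂ (inj₁ (refl , refl))) w) | inj₂ (i , j , i+j<l , inj₂ (_ , w₂)) =
  inj₁ (Walk-weaken (m≤n⇒m≤1+n (≤-trans (m≤n+m j (suc i)) i+j<l)) w₂)
Walk-PlusEdge (step (inj₂ (inj₂ (refl , refl))) w) | inj₁ w′ =
  inj₂ (0 , _ , ≤-refl , inj₂ (stop , w′))
Walk-PlusEdge (step (inj₂ (inj₂ (refl , refl))) w) | inj₂ (i , j , i+j<l , inj₂ (_ , w₂)) =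
  inj₂ (0 , j , s≤s (≤-trans (m≤n+m j (suc i)) i+j<l) , inj₂ (stop , w₂))
Walk-PlusEdge (step (inj₂ (inj₂ (refl , refl))) w) | inj₂ (i , j , i+j<l , inj₁ (_ , w₂)) =
  inj₁ (Walk-weaken (m≤n⇒m≤1+n (≤-trans (m≤n+m j (suc i)) i+j<l)) w₂)

-- Let a short walk join the ends of an edge `xy` while avoiding it. If `xy` is the new edge, the
-- walk is old and puts `v` in the ball around `u`. If `xy` is old, either the walk is old too,
-- against the girth of `N`, or it splits at the new edge into two old pieces of total length less
-- than `g`; joined by `xy` they form a walk of length at most `g` between `u` and `v`.
addEdge-LargeGirth : ∀ {n} (u v : Fin n) N g → Symm N → LargeGirth g N → v ∉ ball N g u →
                     LargeGirth g (addEdge u v N)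
addEdge-LargeGirth u v N g N-sym girth far {x} {y} y∈ w with addEdge⁻ u v N x y∈
... | inj₂ (inj₁ (refl , refl)) = far (Walk⇒∈ball N (Walk-map old w))
  where
  old : ∀ {a b} → Avoiding (addEdge x y N) x y a b → b ∈ N a
  old {a} (b∈ , ≢xy , ≢yx) with addEdge⁻ x y N a b∈
  ... | inj₁ b∈′       = b∈′
  ... | inj₂ (inj₁ xy) = contradiction xy ≢xy
  ... | inj₂ (inj₂ yx) = contradiction yx ≢yx
... | inj₂ (inj₂ (refl , refl)) = far (Walk⇒∈ball N (Walk-reverse N-sym (Walk-map old w)))
  where
  old : ∀ {a b} → Avoiding (addEdge y x N) x y a b → b ∈ N a
  old {a} (b∈ , ≢xy , ≢yx) with addEdge⁻ y x N a b∈
  ... | inj₁ b∈′       = b∈′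
  ... | inj₂ (inj₁ yx) = contradiction yx ≢yx
  ... | inj₂ (inj₂ xy) = contradiction xy ≢xy
... | inj₁ y∈′ with Walk-PlusEdge (Walk-map split w)
  where
  split : ∀ {a b} → Avoiding (addEdge u v N) x y a b → PlusEdge (Avoiding N x y) u v a b
  split {a} (b∈ , avoids) with addEdge⁻ u v N a b∈
  ... | inj₁ b∈′ = inj₁ (b∈′ , avoids)
  ... | inj₂ new = inj₂ new
...   | inj₁ w′ = girth y∈′ w′
...   | inj₂ (i , j , i+j<g , inj₁ (x⇝u , v⇝y)) =
  far (Walk⇒∈ball N (Walk-weaken (subst (_≤ g) (sym (+-suc i j)) i+j<g)
    (Walk-++ (Walk-reverse N-sym (Walk-map proj₁ x⇝u))
             (step y∈′ (Walk-reverse N-sym (Walk-map proj₁ v⇝y))))))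
...   | inj₂ (i , j , i+j<g , inj₂ (x⇝v , u⇝y)) =
  far (Walk⇒∈ball N (Walk-weaken
    (subst (_≤ g) (trans (cong suc (+-comm i j)) (sym (+-suc j i))) i+j<g)
    (Walk-++ (Walk-map proj₁ u⇝y) (step (N-sym y∈′) (Walk-map proj₁ x⇝v)))))

-- The greedy construction

-- A pair of large sets that still violates the expansion property; the two sets may overlap.
Bad : ∀ {n} → Nbhd n → ℕ → Subset n × Subset n → Set
Bad N s (A , B) = s ≤ # (_∈ˢ? A) × s ≤ # (_∈ˢ? B) × (∀ u v → u ∈ˢ A → v ∈ˢ B → v ∉ N u)

abstract
  Bad? : ∀ {n} (N : Nbhd n) s x → Dec (Bad N s x)
  Bad? N s (A , B) = (s ≤? _) ×-dec (s ≤? _) ×-dec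
    Finₚ.all? λ u → Finₚ.all? λ v → (u ∈ˢ? A) →-dec ((v ∈ˢ? B) →-dec ¬? (v ∈? N u))

badPairs : ∀ {n} → Nbhd n → ℕ → ℕ
badPairs {n} N s = ∑ (subsetPairs n) (𝟙 ∘ Bad? N s)

Available : ∀ {n} → Nbhd n → ℕ → ℕ → Fin n → Fin n → Set
Available N D g u v = length (N u) < D × length (N v) < D × v ∉ ball N g u

abstract
  Available? : ∀ {n} (N : Nbhd n) D g u v → Dec (Available N D g u v)
  Available? N D g u v = (_ <? D) ×-dec (_ <? D) ×-dec ¬? (v ∈? ball N g u)

Joins : ∀ {n} → Nbhd n → ℕ → ℕ → Subset n × Subset n → Fin n → Fin n → Set
Joins N D g (A , B) u v = u ∈ˢ A × v ∈ˢ B × Available N D g u v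

abstract
  Joins? : ∀ {n} (N : Nbhd n) D g x u v → Dec (Joins N D g x u v)
  Joins? N D g (A , B) u v = (u ∈ˢ? A) ×-dec (v ∈ˢ? B) ×-dec Available? N D g u v

-- `t` counts steps, and a step may leave the graph unchanged. So `sumDeg` says that there are at
-- most `t` edges, each counted at both ends.
record Sparse {n} (g D t : ℕ) (N : Nbhd n) : Set where
  field
    symm   : Symm N
    girth  : LargeGirth g N
    maxDeg : ∀ x → length (N x) ≤ D
    sumDeg : ∑ (allFin n) (length ∘ N) ≤ 2 * t

-- Markov's inequality: every vertex of degree at least `D` contributes at least `D` to the degree
-- sum.
#-high : ∀ {n} (N : Nbhd n) D w → 0 < D → ∑ (allFin n) (length ∘ N) ≤ D * w →
         # (λ x → D ≤? length (N x)) ≤ w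
#-high {n} N D@(suc _) w _ ∑≤ = *-cancelʳ-≤ _ w D (begin
  # (λ x → D ≤? length (N x)) * D
    ≡⟨ sym (∑-*ʳ (allFin n) _ D) ⟩
  ∑ (allFin n) (λ x → 𝟙 (D ≤? length (N x)) * D)
    ≤⟨ ∑-mono (allFin n) (λ x → markov (D ≤? length (N x))) ⟩
  ∑ (allFin n) (length ∘ N)
    ≤⟨ ∑≤ ⟩
  D * w
    ≡⟨ *-comm D w ⟩
  w * D ∎)
  where
  open ≤-Reasoning
  markov : ∀ {l} (D≤?l : Dec (D ≤ l)) → 𝟙 D≤?l * D ≤ l
  markov (yes D≤l) = ≤-trans (≤-reflexive (*-identityˡ D)) D≤l
  markov (no _)    = z≤n

-- The factor 3 leaves room for two losses. Removing the at most `w` vertices of high degree leaves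
-- `2 * w` vertices in each set; for each such `u` in `A`, removing the ball around `u` from `B`
-- still leaves `w` choices of `v`.
Bad⇒manyJoins : ∀ {n} (N : Nbhd n) D g w x → # (λ x → D ≤? length (N x)) ≤ w →
  (∀ u → length (ball N g u) ≤ w) → Bad N (3 * w) x →
  w * w ≤ ∑ (allFin n) (λ u → ∑ (allFin n) (λ v → 𝟙 (Joins? N D g x u v)))
Bad⇒manyJoins {n} N D g w x@(A , B) high≤w ball≤w (3w≤A , 3w≤B , _) = begin
  w * w                                          ≤⟨ *-monoˡ-≤ w w≤lowA ⟩
  # lowA? * w                                    ≡⟨ sym (∑-*ʳ (allFin n) (𝟙 ∘ lowA?) w) ⟩
  ∑ (allFin n) (λ u → 𝟙 (lowA? u) * w)           ≤⟨ ∑-mono (allFin n) joins-at ⟩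
  ∑ (allFin n) (λ u → # (Joins? N D g x u))      ∎
  where
  open ≤-Reasoning
  high? : ∀ x → Dec (D ≤ length (N x))
  high? x = D ≤? length (N x)

  lowA? : ∀ u → Dec (u ∈ˢ A × length (N u) < D)
  lowA? u = (u ∈ˢ? A) ×-dec (length (N u) <? D)

  lowB? : ∀ v → Dec (v ∈ˢ B × length (N v) < D)
  lowB? v = (v ∈ˢ? B) ×-dec (length (N v) <? D)

  lowOrHigh : ∀ {P : Set} u → P → (P × length (N u) < D) ⊎ D ≤ length (N u)
  lowOrHigh u p with length (N u) <? D
  ... | yes low = inj₁ (p , low)
  ... | no ¬low = inj₂ (≮⇒≥ ¬low)

  2w≤ : ∀ {k} → 3 * w ≤ k + w → 2 * w ≤ k
  2w≤ {k} 3w≤ = +-cancelʳ-≤ w (2 * w) k (subst (_≤ k + w) (+-comm w (2 * w)) 3w≤)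

  w≤ : ∀ {k} → 2 * w ≤ k + w → w ≤ k
  w≤ {k} 2w≤ = +-cancelʳ-≤ w w k (subst (λ z → w + z ≤ k + w) (+-identityʳ w) 2w≤)

  w≤lowA : w ≤ # lowA?
  w≤lowA = ≤-trans (m≤m+n w _) (2w≤ (≤-trans 3w≤A (≤-trans
    (#-cover (_∈ˢ? A) lowA? high? λ u → lowOrHigh u) (+-monoʳ-≤ _ high≤w))))

  2w≤lowB : 2 * w ≤ # lowB?
  2w≤lowB = 2w≤ (≤-trans 3w≤B (≤-trans
    (#-cover (_∈ˢ? B) lowB? high? λ u → lowOrHigh u) (+-monoʳ-≤ _ high≤w)))

  joins-at : ∀ u → 𝟙 (lowA? u) * w ≤ # (Joins? N D g x u)
  joins-at u with lowA? u
  ... | no _               = z≤n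
  ... | yes (u∈A , u-low) = ≤-trans (≤-reflexive (*-identityˡ w)) (w≤ (≤-trans 2w≤lowB (≤-trans
    (#-cover lowB? (Joins? N D g x u) (_∈? ball N g u) joinsOrNear)
    (+-monoʳ-≤ _ (≤-trans (#-∈-list (ball N g u) (_∈? ball N g u)) (ball≤w u))))))
    where
    joinsOrNear : ∀ v → v ∈ˢ B × length (N v) < D → Joins N D g x u v ⊎ v ∈ ball N g u
    joinsOrNear v (v∈B , v-low) with v ∈? ball N g u
    ... | yes near = inj₂ near
    ... | no far   = inj₁ (u∈A , v∈B , u-low , v-low , far)

root∈ball : ∀ {n} (N : Nbhd n) g u → u ∈ ball N g u
root∈ball N zero    u = here refl
root∈ball N (suc g) u = here refl

addEdge-Sparse : ∀ {n} {g D t} {N : Nbhd n} {u v} → Sparse g D t N → Available N D g u v →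
                 Sparse g D (suc t) (addEdge u v N)
addEdge-Sparse {n} {g} {D} {t} {N} {u} {v} S (u-low , v-low , far) = record
  { symm   = λ {x} {y} → addEdge-Symm u v N (Sparse.symm S) {x} {y}
  ; girth  = λ {x} {y} → addEdge-LargeGirth u v N g (Sparse.symm S) (Sparse.girth S) far {x} {y}
  ; maxDeg = λ x → subst (_≤ D) (sym (length-addEdge x)) (deg≤D x)
  ; sumDeg = ≤-trans (≤-reflexive (trans (∑-cong (allFin n) length-addEdge)
      (trans (∑-+ (allFin n) _ _) (cong (# (Finₚ._≟ v) +_) (∑-+ (allFin n) _ _)))))
      (≤-trans (+-mono-≤ (single v) (+-mono-≤ (single u) (Sparse.sumDeg S)))
      (≤-reflexive (sym (*-suc 2 t))))
  }
  where
  length-addEdge : ∀ x → length (addEdge u v N x) ≡ 𝟙 (x Finₚ.≟ v) + (𝟙 (x Finₚ.≟ u) + length (N x))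
  length-addEdge x = trans (length-addArc v u (addArc u v N) x)
    (cong (𝟙 (x Finₚ.≟ v) +_) (length-addArc u v N x))

  single : ∀ y → # (Finₚ._≟ y) ≤ 1
  single y = #-subsingleton (Finₚ._≟ y) λ _ _ a≡y b≡y → trans a≡y (sym b≡y)

  deg≤D : ∀ x → 𝟙 (x Finₚ.≟ v) + (𝟙 (x Finₚ.≟ u) + length (N x)) ≤ D
  deg≤D x with x Finₚ.≟ v | x Finₚ.≟ u
  -- The new edge is not a loop, since `u` lies in its own ball; hence each list grows by at most
  -- one entry.
  ... | yes refl | yes refl = contradiction (root∈ball N g x) far
  ... | yes refl | no _     = v-low
  ... | no _     | yes refl = u-low
  ... | no _     | no _     = Sparse.maxDeg S x

-- Double counting: each bad pair is joined by at least `w * w` of the `K * w * (K * w)` ordered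
-- vertex pairs, so some `(u , v)` joins a proportion `1 / (K * K)` of the bad pairs.
greedyStep : ∀ {n} g D K w t (N : Nbhd n) → Fin n → n ≡ K * w → .{{_ : NonZero w}} → 0 < D →
  2 * t ≤ D * w → ballBound D g ≤ w → Sparse g D t N →
  ∃ λ N′ → Sparse g D (suc t) N′ ×
    suc (K * K) * badPairs N′ (3 * w) ≤ K * K * badPairs N (3 * w)
greedyStep {n} g D K w t N x₀ n≡Kw 0<D 2t≤Dw bb≤w S = conclude u v Φ≤ (Available? N D g u v)
  where
  open ≤-Reasoning
  pairs = subsetPairs n
  V = allFin n
  Φ = badPairs N (3 * w)

  hit? : ∀ u v x → Dec (Bad N (3 * w) x × Joins N D g x u v)
  hit? u v x = Bad? N (3 * w) x ×-dec Joins? N D g x u v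

  hits : Fin n → Fin n → ℕ
  hits u v = ∑ pairs (λ x → 𝟙 (hit? u v x))

  many : ∀ x → 𝟙 (Bad? N (3 * w) x) * (w * w) ≤ ∑ V (λ u → ∑ V (λ v → 𝟙 (hit? u v x)))
  many x with Bad? N (3 * w) x
  ... | no _    = z≤n
  ... | yes bad = ≤-trans (≤-reflexive (*-identityˡ (w * w))) (≤-trans
    (Bad⇒manyJoins N D g w x
      (#-high N D w 0<D (≤-trans (Sparse.sumDeg S) 2t≤Dw))
      (λ u → ≤-trans (length-ball N D (Sparse.maxDeg S) g u) bb≤w) bad)
    (∑-mono V λ u → ∑-mono V λ v →
      𝟙-mono (Joins? N D g x u v) (yes bad ×-dec Joins? N D g x u v) (bad ,_)))

  double-count : Φ * (w * w) ≤ ∑ V (λ u → ∑ V (hits u))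
  double-count = begin
    Φ * (w * w)                                                     ≡⟨ sym (∑-*ʳ pairs _ (w * w)) ⟩
    ∑ pairs (λ x → 𝟙 (Bad? N (3 * w) x) * (w * w))                  ≤⟨ ∑-mono pairs many ⟩
    ∑ pairs (λ x → ∑ V (λ u → ∑ V (λ v → 𝟙 (hit? u v x))))          ≡⟨ ∑-swap pairs V _ ⟩
    ∑ V (λ u → ∑ pairs (λ x → ∑ V (λ v → 𝟙 (hit? u v x))))          ≡⟨ ∑-cong V (λ u → ∑-swap pairs V _) ⟩
    ∑ V (λ u → ∑ V (hits u))                                        ∎

  best-u = ∑-max x₀ V (λ u → ∑ V (hits u))
  u = proj₁ best-u
  best-v = ∑-max x₀ V (hits u)
  v = proj₁ best-v

  rearrange : ∀ K w h → K * w * (K * w * h) ≡ K * K * h * (w * w)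
  rearrange = solve-∀

  Φ≤ : Φ ≤ K * K * hits u v
  Φ≤ = *-cancelʳ-≤ Φ _ (w * w) {{m*n≢0 w w}} (begin
    Φ * (w * w)                           ≤⟨ double-count ⟩
    ∑ V (λ u → ∑ V (hits u))              ≤⟨ proj₂ best-u ⟩
    length V * ∑ V (hits u)               ≤⟨ *-monoʳ-≤ (length V) (proj₂ best-v) ⟩
    length V * (length V * hits u v)      ≡⟨ cong (λ k → k * (k * hits u v)) (trans (length-tabulate id) n≡Kw) ⟩
    K * w * (K * w * hits u v)            ≡⟨ rearrange K w (hits u v) ⟩
    K * K * hits u v * (w * w)            ∎)

  conclude : ∀ u v → Φ ≤ K * K * hits u v → Dec (Available N D g u v) →
    ∃ λ N′ → Sparse g D (suc t) N′ × suc (K * K) * badPairs N′ (3 * w) ≤ K * K * Φ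
  conclude u v Φ≤ (no ¬avail) = N , longer , no-bad
    where
    longer : Sparse g D (suc t) N
    longer = record
      { symm = symm ; girth = girth ; maxDeg = maxDeg
      ; sumDeg = ≤-trans sumDeg (*-monoʳ-≤ 2 (n≤1+n t)) }
      where open Sparse S

    no-hits : hits u v ≡ 0
    no-hits = trans (∑-cong pairs λ x → 𝟙-false (hit? u v x) λ { (_ , _ , _ , avail) → ¬avail avail })
      (trans (∑-const pairs 0) (*-zeroʳ (length pairs)))

    Φ≡0 : Φ ≡ 0
    Φ≡0 = n≤0⇒n≡0 (≤-trans Φ≤ (≤-reflexive (trans (cong (K * K *_) no-hits) (*-zeroʳ (K * K)))))

    no-bad : suc (K * K) * Φ ≤ K * K * Φ
    no-bad = begin
      suc (K * K) * Φ  ≡⟨ cong (suc (K * K) *_) Φ≡0 ⟩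
      suc (K * K) * 0  ≡⟨ *-zeroʳ (K * K) ⟩
      0                ≤⟨ z≤n ⟩
      K * K * Φ        ∎
  conclude u v Φ≤ (yes avail) = N′ , addEdge-Sparse S avail , fewer
    where
    N′ = addEdge u v N
    Φ′ = badPairs N′ (3 * w)

    still-bad : ∀ x → Bad N′ (3 * w) x → Bad N (3 * w) x
    still-bad x (s≤A , s≤B , sep) = s≤A , s≤B , λ a b a∈A b∈B b∈Na → sep a b a∈A b∈B (addEdge-old u v N a b∈Na)

    -- New edges create no bad pairs, and a pair joined by `u` and `v` stops being bad.
    Φ′+hits : Φ′ + hits u v ≤ Φ
    Φ′+hits = ≤-trans (≤-reflexive (sym (∑-+ pairs _ _))) (∑-mono pairs λ x →
      𝟙-disjoint (Bad? N′ (3 * w) x) (hit? u v x) (Bad? N (3 * w) x) (still-bad x) proj₁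
        λ { (_ , _ , sep) (_ , u∈A , v∈B , _) → sep u v u∈A v∈B (addEdge-new u v N) })

    fewer : suc (K * K) * Φ′ ≤ K * K * Φ
    fewer = begin
      -- The single copy of `Φ′` is at most `Φ`, which averaging bounds by `K * K * hits u v`; this
      -- yields the factor `K * K / suc (K * K)`.
      Φ′ + K * K * Φ′              ≤⟨ +-monoˡ-≤ _ (≤-trans (m+n≤o⇒m≤o Φ′ Φ′+hits) Φ≤) ⟩
      K * K * hits u v + K * K * Φ′  ≡⟨ sym (*-distribˡ-+ (K * K) (hits u v) Φ′) ⟩
      K * K * (hits u v + Φ′)      ≡⟨ cong (K * K *_) (+-comm (hits u v) Φ′) ⟩
      K * K * (Φ′ + hits u v)      ≤⟨ *-monoʳ-≤ (K * K) Φ′+hits ⟩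
      K * K * Φ                    ∎

-- Iterating the step until no bad pair is left

badPairs≤4^n : ∀ {n} (N : Nbhd n) s → badPairs N s ≤ 4 ^ n
badPairs≤4^n {n} N s = begin
  badPairs N s                  ≤⟨ ∑-mono (subsetPairs n) (λ x → 𝟙≤1 (Bad? N s x)) ⟩
  ∑ (subsetPairs n) (λ _ → 1)   ≡⟨ ∑-const (subsetPairs n) 1 ⟩
  length (subsetPairs n) * 1    ≡⟨ trans (*-identityʳ _) (length-subsetPairs n) ⟩
  4 ^ n                         ∎
  where open ≤-Reasoning

empty-Sparse : ∀ {n} g D → Sparse {n} g D 0 (λ _ → [])
empty-Sparse {n} g D = record
  { symm   = λ ()
  ; girth  = λ ()
  ; maxDeg = λ _ → z≤n
  ; sumDeg = ≤-reflexive (trans (∑-const (allFin n) 0) (*-zeroʳ (length (allFin n))))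
  }

-- With denominators cleared: `b ≤ (p / q) ^ t * a` and `c ≤ (p / q) * b` are multiplied together.
^-step : ∀ p q t {a b c} → q * c ≤ p * b → q ^ t * b ≤ p ^ t * a →
         q ^ suc t * c ≤ p ^ suc t * a
^-step p q t {a} {b} {c} qc≤pb bound = begin
  q * q ^ t * c     ≡⟨ shuffle q (q ^ t) c ⟩
  q ^ t * (q * c)   ≤⟨ *-monoʳ-≤ (q ^ t) qc≤pb ⟩
  q ^ t * (p * b)   ≡⟨ sym (shuffle p (q ^ t) b) ⟩
  p * q ^ t * b     ≡⟨ *-assoc p (q ^ t) b ⟩
  p * (q ^ t * b)   ≤⟨ *-monoʳ-≤ p bound ⟩
  p * (p ^ t * a)   ≡⟨ sym (*-assoc p (p ^ t) a) ⟩
  p * p ^ t * a     ∎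
  where
  open ≤-Reasoning
  shuffle : ∀ a b c → a * b * c ≡ b * (a * c)
  shuffle = solve-∀

-- The condition `2 * t ≤ D * w` keeps the degree sum so low that at most `w` vertices reach degree
-- `D` during the first `t` steps.
greedy : ∀ {n} g D K w → Fin n → n ≡ K * w → .{{_ : NonZero w}} → 0 < D → ballBound D g ≤ w →
  ∀ t → 2 * t ≤ D * w → ∃ λ (N : Nbhd n) → Sparse g D t N ×
    suc (K * K) ^ t * badPairs N (3 * w) ≤ (K * K) ^ t * 4 ^ n
greedy {n} g D K w x₀ n≡Kw 0<D bb≤w zero _ =
  (λ _ → []) , empty-Sparse g D , *-monoʳ-≤ 1 (badPairs≤4^n (λ _ → []) (3 * w))
greedy {n} g D K w x₀ n≡Kw 0<D bb≤w (suc t) 2t+2≤Dw =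
  extend (greedy g D K w x₀ n≡Kw 0<D bb≤w t 2t≤Dw)
  where
  2t≤Dw : 2 * t ≤ D * w
  2t≤Dw = ≤-trans (*-monoʳ-≤ 2 (n≤1+n t)) 2t+2≤Dw

  extend : (∃ λ (N : Nbhd n) → Sparse g D t N ×
             suc (K * K) ^ t * badPairs N (3 * w) ≤ (K * K) ^ t * 4 ^ n) →
           ∃ λ (N : Nbhd n) → Sparse g D (suc t) N ×
             suc (K * K) ^ suc t * badPairs N (3 * w) ≤ (K * K) ^ suc t * 4 ^ n
  extend (N , S , bound) = proj₁ next , proj₁ (proj₂ next) ,
    ^-step (K * K) (suc (K * K)) t (proj₂ (proj₂ next)) bound
    where next = greedyStep g D K w t N x₀ n≡Kw 0<D 2t≤Dw bb≤w S

-- Bernoulli's inequality `1 + k / p ≤ (1 + 1 / p) ^ k` with denominators cleared.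
bernoulli : ∀ p k → p ^ k * (p + k) ≤ suc p ^ k * p
bernoulli p zero    = ≤-reflexive (cong (_+ 0) (+-identityʳ p))
bernoulli p (suc k) = begin
  p * p ^ k * (p + suc k)          ≤⟨ m≤m+n _ (p ^ k * k) ⟩
  p * p ^ k * (p + suc k) + p ^ k * k  ≡⟨ expand p (p ^ k) k ⟩
  suc p * (p ^ k * (p + k))        ≤⟨ *-monoʳ-≤ (suc p) (bernoulli p k) ⟩
  suc p * (suc p ^ k * p)          ≡⟨ sym (*-assoc (suc p) (suc p ^ k) p) ⟩
  suc p * suc p ^ k * p            ∎
  where
  open ≤-Reasoning
  expand : ∀ p x k → p * x * (p + suc k) + x * k ≡ suc p * (x * (p + k))
  expand = solve-∀

-- Bernoulli's inequality at `k = 4 * p` gives `(1 + 1 / p) ^ (4 * p) ≥ 5`.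
4*p^<[1+p]^ : ∀ p .{{_ : NonZero p}} → 4 * p ^ (4 * p) < suc p ^ (4 * p)
4*p^<[1+p]^ p = begin-strict
  4 * p ^ (4 * p)   <⟨ *-monoˡ-< (p ^ (4 * p)) {{m^n≢0 p (4 * p)}} (n<1+n 4) ⟩
  5 * p ^ (4 * p)   ≤⟨ *-cancelʳ-≤ _ _ p (≤-trans (≤-reflexive (regroup p (p ^ (4 * p)))) (bernoulli p (4 * p))) ⟩
  suc p ^ (4 * p)   ∎
  where
  open ≤-Reasoning
  regroup : ∀ p x → 5 * x * p ≡ x * (p + 4 * p)
  regroup = solve-∀

^-distrib-* : ∀ a b n → (a * b) ^ n ≡ a ^ n * b ^ n
^-distrib-* a b zero    = refl
^-distrib-* a b (suc n) rewrite ^-distrib-* a b n = interchange a b (a ^ n) (b ^ n)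
  where
  interchange : ∀ a b c d → a * b * (c * d) ≡ a * c * (b * d)
  interchange = solve-∀

m<n∧n*k≤m⇒k≡0 : ∀ {m n k} → m < n → n * k ≤ m → k ≡ 0
m<n∧n*k≤m⇒k≡0 {k = zero}      m<n nk≤m = refl
m<n∧n*k≤m⇒k≡0 {n = n} {suc k} m<n nk≤m =
  contradiction (≤-trans (m≤m*n n (suc k)) nk≤m) (<⇒≱ m<n)

noBadPairs : ∀ {n} (N : Nbhd n) s → badPairs N s ≡ 0 → ∀ x → ¬ Bad N s x
noBadPairs N s none x bad = contradiction (begin
  1                   ≡⟨ sym (𝟙-true (Bad? N s x) bad) ⟩
  𝟙 (Bad? N s x)      ≤⟨ ∈⇒≤∑ (𝟙 ∘ Bad? N s) (∈-subsetPairs x) ⟩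
  badPairs N s        ≡⟨ none ⟩
  0                   ∎) λ ()
  where open ≤-Reasoning

-- The previous estimate raised to the power `n`: after `4 * p * n` steps the upper bound for the
-- number of bad pairs is less than 1.
p^T*4^n<[1+p]^T : ∀ p n .{{_ : NonZero p}} .{{_ : NonZero n}} →
                  p ^ (4 * p * n) * 4 ^ n < suc p ^ (4 * p * n)
p^T*4^n<[1+p]^T p n = begin-strict
  p ^ (4 * p * n) * 4 ^ n     ≡⟨ cong (_* 4 ^ n) (sym (^-*-assoc p (4 * p) n)) ⟩
  (p ^ (4 * p)) ^ n * 4 ^ n   ≡⟨ *-comm _ (4 ^ n) ⟩
  4 ^ n * (p ^ (4 * p)) ^ n   ≡⟨ sym (^-distrib-* 4 (p ^ (4 * p)) n) ⟩
  (4 * p ^ (4 * p)) ^ n       <⟨ ^-monoˡ-< n (4*p^<[1+p]^ p) ⟩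
  (suc p ^ (4 * p)) ^ n       ≡⟨ ^-*-assoc (suc p) (4 * p) n ⟩
  suc p ^ (4 * p * n)         ∎
  where open ≤-Reasoning

ballBound≢0 : ∀ D g → NonZero (ballBound D g)
ballBound≢0 D zero    = _
ballBound≢0 D (suc g) = _

-- With p = K² the number of bad pairs falls by the factor p / (1 + p) in each step, and
-- ((1 + p) / p) ^ (4 p) > 4; the degree bound D makes D w = 2 T.
sparseExpander : ∀ g K .{{_ : NonZero K}} → ∃ λ w → NonZero w × ∃ λ (N : Nbhd (K * w)) →
  Symm N × LargeGirth g N × (∀ x → ¬ Bad N (3 * w) x)
sparseExpander g K = w , w≢0 , built (greedy g D K w x₀ refl {{w≢0}} 0<D ≤-refl T (≤-reflexive (regroup (4 * p) K w)))
  where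
  p D w T : ℕ
  p = K * K
  D = 2 * (4 * p * K)
  -- There is no circularity: `D` depends on `K` alone, so the ball bound can serve as `w`, and only
  -- then is the number `K * w` of vertices fixed.
  w = ballBound D g
  T = 4 * p * (K * w)

  w≢0 : NonZero w
  w≢0 = ballBound≢0 D g

  p≢0 : NonZero p
  p≢0 = m*n≢0 K K

  instance
    Kw≢0 : NonZero (K * w)
    Kw≢0 = m*n≢0 K w {{it}} {{w≢0}}

  x₀ : Fin (K * w)
  x₀ = Fin.fromℕ< (>-nonZero⁻¹ (K * w))

  0<D : 0 < D
  0<D = >-nonZero⁻¹ D {{m*n≢0 2 (4 * p * K) {{it}} {{m*n≢0 (4 * p) K {{m*n≢0 4 p {{it}} {{p≢0}}}}}}}}

  regroup : ∀ c K w → 2 * (c * (K * w)) ≡ 2 * (c * K) * w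
  regroup = solve-∀

  built : (∃ λ (N : Nbhd (K * w)) → Sparse g D T N ×
            suc p ^ T * badPairs N (3 * w) ≤ p ^ T * 4 ^ (K * w)) →
          ∃ λ (N : Nbhd (K * w)) → Symm N × LargeGirth g N × (∀ x → ¬ Bad N (3 * w) x)
  built (N , S , bound) = N , symm , girth ,
    noBadPairs N (3 * w) (m<n∧n*k≤m⇒k≡0 (p^T*4^n<[1+p]^T p (K * w) {{p≢0}}) bound)
    where open Sparse S

-- Tournaments with a given backedge graph

-- Arcs go upwards except along edges of `N`, so for symmetric `N` the backedge graph of the natural
-- order consists of the edges of `N`.
Arc : ∀ {n} → Nbhd n → Fin n → Fin n → Set
Arc N u v = (u Fin.< v × v ∉ N u) ⊎ (v Fin.< u × v ∈ N u)

backTournament : ∀ {n} (N : Nbhd n) → Symm N → Tournament n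
backTournament N N-sym = record { _⟶_ = Arc N ; compare = cmp }
  where
  cmp : ∀ u v → Tri (Arc N u v) (u ≡ v) (Arc N v u)
  cmp u v with Finₚ.<-cmp u v | v ∈? N u
  ... | tri≈ _ refl _     | _      = tri≈ irrefl refl irrefl
    where
    irrefl : ¬ Arc N u u
    irrefl (inj₁ (u<u , _)) = Finₚ.<-irrefl refl u<u
    irrefl (inj₂ (u<u , _)) = Finₚ.<-irrefl refl u<u
  ... | tri< u<v u≢v v≮u | no v∉ = tri< (inj₁ (u<v , v∉)) u≢v
    λ { (inj₁ (v<u , _)) → v≮u v<u ; (inj₂ (_ , u∈)) → v∉ (N-sym u∈) }
  ... | tri< u<v u≢v v≮u | yes v∈ = tri> (λ { (inj₁ (_ , v∉)) → v∉ v∈ ; (inj₂ (v<u , _)) → v≮u v<u }) u≢v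
    (inj₂ (u<v , N-sym v∈))
  ... | tri> u≮v u≢v v<u | no v∉ = tri> (λ { (inj₁ (u<v , _)) → u≮v u<v ; (inj₂ (_ , v∈)) → v∉ v∈ }) u≢v
    (inj₁ (v<u , λ u∈ → v∉ (N-sym u∈)))
  ... | tri> u≮v u≢v v<u | yes v∈ = tri< (inj₂ (v<u , v∈)) u≢v
    λ { (inj₁ (_ , u∉)) → u∉ (N-sym v∈) ; (inj₂ (u<v , _)) → u≮v u<v }

-- Cutting a pure pair at a vertex

intermediateValue : (f : ℕ → ℕ) → f 0 ≡ 0 → (∀ t → f (suc t) ≤ suc (f t)) →
                    ∀ n {s} → s ≤ f n → ∃ λ t → f t ≡ s
intermediateValue f f0≡0 f-step zero    s≤f0 = 0 , trans f0≡0 (sym (n≤0⇒n≡0 (≤-trans s≤f0 (≤-reflexive f0≡0))))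
intermediateValue f f0≡0 f-step (suc n) {s} s≤f with s ≤? f n
... | yes s≤fn = intermediateValue f f0≡0 f-step n s≤fn
... | no s≰fn  = suc n , ≤-antisym (≤-trans (f-step n) (≰⇒> s≰fn)) s≤f

Below : ∀ {n} → Subset n → ℕ → Fin n → Set
Below A t x = x ∈ˢ A × toℕ x < t

Below? : ∀ {n} (A : Subset n) t x → Dec (Below A t x)
Below? A t x = (x ∈ˢ? A) ×-dec (toℕ x <? t)

Above : ∀ {n} → Subset n → ℕ → Fin n → Set
Above A t x = x ∈ˢ A × t ≤ toℕ x

Above? : ∀ {n} (A : Subset n) t x → Dec (Above A t x)
Above? A t x = (x ∈ˢ? A) ×-dec (t ≤? toℕ x)

#≤#Below+#Above : ∀ {n} (A : Subset n) t → # (_∈ˢ? A) ≤ # (Below? A t) + # (Above? A t)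
#≤#Below+#Above A t = #-cover (_∈ˢ? A) (Below? A t) (Above? A t) split
  where
  split : ∀ x → x ∈ˢ A → Below A t x ⊎ Above A t x
  split x x∈A with toℕ x <? t
  ... | yes x<t = inj₁ (x∈A , x<t)
  ... | no x≮t  = inj₂ (x∈A , ≮⇒≥ x≮t)

-- Raising the threshold by one admits at most one more vertex, so the count skips no value on its
-- way from 0 to the size of `A`.
∃-threshold : ∀ {n} (A : Subset n) s → s ≤ # (_∈ˢ? A) → ∃ λ t → # (Below? A t) ≡ s
∃-threshold {n} A s s≤A = intermediateValue (λ t → # (Below? A t)) none one-more n
  (≤-trans s≤A (#-mono (_∈ˢ? A) (Below? A n) λ x x∈A → x∈A , Finₚ.toℕ<n x))
  where
  none : # (Below? A 0) ≡ 0
  none = trans (∑-cong (allFin n) λ x → 𝟙-false (Below? A 0 x) λ { (_ , ()) })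
    (trans (∑-const (allFin n) 0) (*-zeroʳ (length (allFin n))))

  one-more : ∀ t → # (Below? A (suc t)) ≤ suc (# (Below? A t))
  one-more t = ≤-trans
    (#-cover (Below? A (suc t)) at? (Below? A t) split)
    (+-monoˡ-≤ _ (#-subsingleton at? λ x y x≡t y≡t → Finₚ.toℕ-injective (trans x≡t (sym y≡t))))
    where
    at? : ∀ x → Dec (toℕ x ≡ t)
    at? x = toℕ x ≟ t

    split : ∀ x → Below A (suc t) x → toℕ x ≡ t ⊎ Below A t x
    split x (x∈A , x<1+t) with toℕ x ≟ t
    ... | yes x≡t = inj₁ x≡t
    ... | no x≢t  = inj₂ (x∈A , ≤∧≢⇒< (s≤s⁻¹ x<1+t) x≢t)

-- The path `a`, `b′`, `a′`, `b` has length 3 and avoids the edge `ab`, with which it closes a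
-- 4-cycle.
no-K₂₂ : ∀ {n} (N : Nbhd n) g → Symm N → LargeGirth g N → 3 ≤ g → ∀ {a a′ b b′} →
         a ≢ a′ → b ≢ b′ → a ≢ b → a′ ≢ b → a ≢ b′ →
         b ∈ N a → b′ ∈ N a → b ∈ N a′ → b′ ∈ N a′ → ⊥
no-K₂₂ N g N-sym girth 3≤g a≢a′ b≢b′ a≢b a′≢b a≢b′ ab ab′ a′b a′b′ = girth ab (Walk-weaken 3≤g
  (step (ab′ , (λ { (_ , b′≡b) → b≢b′ (sym b′≡b) }) , (λ { (a≡b , _) → a≢b a≡b }))
  (step (N-sym a′b′ , (λ { (b′≡a , _) → a≢b′ (sym b′≡a) }) , (λ { (b′≡b , _) → b≢b′ (sym b′≡b) }))
  (step (a′b , (λ { (a′≡a , _) → a≢a′ (sym a′≡a) }) , (λ { (a′≡b , _) → a′≢b a′≡b }))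
  (stop {l = 0})))))

-- Cut at a vertex t that halves A.  Either B has many elements after t, and then the arcs from the
-- first half of A to those show that there are no edges between them; or B has many before t,
-- and then the arcs from the second half of A to those are all edges.
noPurePair : ∀ {n} (N : Nbhd n) g w → .{{NonZero w}} → (N-sym : Symm N) → LargeGirth g N → 3 ≤ g →
  (∀ x → ¬ Bad N (3 * w) x) → (A B : Subset n) → (∀ {a b} → a ∈ˢ A → b ∈ˢ B → Arc N a b) →
  6 * w ≤ ∣ A ∣ → 6 * w ≤ ∣ B ∣ → ⊥
noPurePair N g w@(suc _) N-sym girth 3≤g no-bad A B pure 6w≤A 6w≤B =
  cut (∃-threshold A (3 * w) (≤-trans (*-monoˡ-≤ w {3} {6} (s≤s (s≤s (s≤s z≤n)))) (≤#_ A 6w≤A)))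
  where
  ≤#_ : ∀ C → 6 * w ≤ ∣ C ∣ → 6 * w ≤ # (_∈ˢ? C)
  ≤#_ C = subst (6 * w ≤_) (∣∣≡# C)

  6w : 6 * w ≡ 3 * w + 3 * w
  6w = *-distribʳ-+ w 3 3

  -- The 4-cycle takes two vertices from each side.
  2≤3w : 2 ≤ 3 * w
  2≤3w = ≤-trans (s≤s (s≤s z≤n)) (*-monoʳ-≤ 3 {1} {w} (s≤s z≤n))

  cut : (∃ λ t → # (Below? A t) ≡ 3 * w) → ⊥
  cut (t , #Below≡3w) = case-B (3 * w ≤? # (Above? B t))
    where
    aboveA : 3 * w ≤ # (Above? A t)
    aboveA = +-cancelˡ-≤ (3 * w) _ _ (subst₂ _≤_ 6w (cong (_+ # (Above? A t)) #Below≡3w)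
      (≤-trans (≤#_ A 6w≤A) (#≤#Below+#Above A t)))

    belowB : ¬ (3 * w ≤ # (Above? B t)) → 3 * w ≤ # (Below? B t)
    belowB few = +-cancelʳ-≤ (3 * w) _ _ (subst (_≤ # (Below? B t) + 3 * w) 6w
      (≤-trans (≤#_ B 6w≤B) (≤-trans (#≤#Below+#Above B t) (+-monoʳ-≤ _ (<⇒≤ (≰⇒> few))))))

    forward : ∀ u v → u ∈ˢ subset (Below? A t) → v ∈ˢ subset (Above? B t) → v ∉ N u
    forward u v u∈ v∈ with ∈-subset⁻ (Below? A t) u∈ | ∈-subset⁻ (Above? B t) v∈
    ... | u∈A , u<t | v∈B , t≤v with pure u∈A v∈B
    ...   | inj₁ (_ , v∉)   = v∉
    ...   | inj₂ (v<u , _) = contradiction (<-≤-trans u<t t≤v) (<-asym v<u)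

    backward : ∀ {a b} → Above A t a → Below B t b → b ∈ N a × a ≢ b
    backward (a∈A , t≤a) (b∈B , b<t) with pure a∈A b∈B
    ... | inj₁ (a<b , _)   = contradiction (<-≤-trans b<t t≤a) (<-asym a<b)
    ... | inj₂ (b<a , b∈) = b∈ , λ { refl → <-irrefl refl b<a }

    four-cycle : (∃ λ a → ∃ λ a′ → a ≢ a′ × Above A t a × Above A t a′) →
                 (∃ λ b → ∃ λ b′ → b ≢ b′ × Below B t b × Below B t b′) → ⊥
    four-cycle (a , a′ , a≢a′ , a∈ , a′∈) (b , b′ , b≢b′ , b∈ , b′∈) =
      no-K₂₂ N g N-sym girth 3≤g a≢a′ b≢b′
        (proj₂ (backward a∈ b∈)) (proj₂ (backward a′∈ b∈)) (proj₂ (backward a∈ b′∈))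
        (proj₁ (backward a∈ b∈)) (proj₁ (backward a∈ b′∈))
        (proj₁ (backward a′∈ b∈)) (proj₁ (backward a′∈ b′∈))

    case-B : Dec (3 * w ≤ # (Above? B t)) → ⊥
    case-B (yes many) = no-bad (subset (Below? A t) , subset (Above? B t))
      ( ≤-trans (≤-reflexive (sym #Below≡3w))
          (#-mono (Below? A t) (_∈ˢ? subset (Below? A t)) λ _ → ∈-subset⁺ (Below? A t))
      , ≤-trans many (#-mono (Above? B t) (_∈ˢ? subset (Above? B t)) λ _ → ∈-subset⁺ (Above? B t))
      , forward)
    case-B (no few) = four-cycle (#-two (Above? A t) (≤-trans 2≤3w aboveA))
                                 (#-two (Below? B t) (≤-trans 2≤3w (belowB few)))

-- Homomorphisms of tournaments

Preserves : ∀ {m n} → Tournament m → Tournament n → (Fin m → Fin n) → Set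
Preserves H G f = ∀ u v → Tournament._⟶_ H u v → Tournament._⟶_ G (f u) (f v)

⟶-dec : ∀ {n} (G : Tournament n) u v → Dec (Tournament._⟶_ G u v)
⟶-dec G u v with Tournament.compare G u v
... | tri< u⟶v _ _ = yes u⟶v
... | tri≈ ¬u⟶v _ _ = no ¬u⟶v
... | tri> ¬u⟶v _ _ = no ¬u⟶v

⟶-irrefl : ∀ {n} (G : Tournament n) {u} → ¬ Tournament._⟶_ G u u
⟶-irrefl G {u} u⟶u with Tournament.compare G u u
... | tri< _ u≢u _   = u≢u refl
... | tri≈ ¬u⟶u _ _  = ¬u⟶u u⟶u
... | tri> ¬u⟶u _ _  = ¬u⟶u u⟶u

-- Two distinct vertices are joined by an arc, which would become a loop if their images coincided.
Preserves⇒injective : ∀ {m n} (H : Tournament m) (G : Tournament n) f → Preserves H G f →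
                      Injective _≡_ _≡_ f
Preserves⇒injective H G f pres {u} {v} fu≡fv with Tournament.compare H u v
... | tri< u⟶v _ _ = contradiction (subst (λ x → Tournament._⟶_ G x (f v)) fu≡fv (pres u v u⟶v)) (⟶-irrefl G)
... | tri≈ _ u≡v _ = u≡v
... | tri> _ _ v⟶u = contradiction (subst (Tournament._⟶_ G (f v)) fu≡fv (pres v u v⟶u)) (⟶-irrefl G)

anyVec? : ∀ {n m} {P : Vec (Fin n) m → Set} → (∀ v → Dec (P v)) → Dec (∃ P)
anyVec? {m = zero}  P? = map′ ([] ,_) (λ { ([] , p) → p }) (P? [])
anyVec? {m = suc m} P? = map′ (λ { (x , v , p) → x ∷ v , p }) (λ { (x ∷ v , p) → x , v , p })
  (Finₚ.any? λ x → anyVec? λ v → P? (x ∷ v))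

-- Exhaustive search over all maps, coded as vectors. It makes the final case distinction, whether
-- `G` contains `H`, constructive.
preserving? : ∀ {m n} (H : Tournament m) (G : Tournament n) →
              Dec (∃ λ (v : Vec (Fin n) m) → Preserves H G (Vec.lookup v))
preserving? H G = anyVec? λ v → Finₚ.all? λ x → Finₚ.all? λ y → ⟶-dec H x y →-dec ⟶-dec G _ _

Contains⇒Preserves : ∀ {m n} (H : Tournament m) (G : Tournament n) → Contains G H →
                     ∃ λ (v : Vec (Fin n) m) → Preserves H G (Vec.lookup v)
Contains⇒Preserves H G (X , φ , iff) = Vec.tabulate f , λ u v u⟶v →
  subst₂ (Tournament._⟶_ G) (sym (Vecₚ.lookup∘tabulate f u)) (sym (Vecₚ.lookup∘tabulate f v))
    (Equivalence.to (iff u v) u⟶v)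
  where f = λ u → proj₁ (Inverse.to φ u)

-- Numberings induced by an injection into an ordered set

-- Pigeonhole: if `y` were missed, deleting it from the codomain would give an injection into a set
-- with one element fewer.
injective⇒surjective : ∀ {m} (f : Fin m → Fin m) → Injective _≡_ _≡_ f → ∀ y → ∃ λ x → f x ≡ y
injective⇒surjective {suc m} f f-inj y with Finₚ.any? (λ x → f x Finₚ.≟ y)
... | yes found = found
... | no missed = contradiction (Finₚ.injective⇒≤ {f = λ x → Fin.punchOut (y≢ x)}
    λ {x} {x′} eq → f-inj (Finₚ.punchOut-injective (y≢ x) (y≢ x′) eq)) 1+n≰n
  where
  y≢ : ∀ x → y ≢ f x
  y≢ x y≡fx = missed (x , sym y≡fx)

-- The index of `u` is the number of vertices mapped below `f u`. This `rank` is the second argument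
-- of `permutation` because the map from vertices to indices is the inverse direction of a
-- numbering.
orderNumbering : ∀ {m n} (f : Fin m → Fin n) → Injective _≡_ _≡_ f →
  ∃ λ (σ : Permutation′ m) → ∀ u v → (σ ⟨$⟩ˡ u) Fin.< (σ ⟨$⟩ˡ v) → f u Fin.< f v
orderNumbering {m} f f-inj = permutation unrank rank unrank-rank rank-unrank , rank-reflects
  where
  lower? : ∀ u x → Dec (f x Fin.< f u)
  lower? u x = f x Finₚ.<? f u

  -- Used twice: with the trivial `P` it shows that ranks are less than `m`, with the lower set of
  -- `v` that `rank` is strictly monotone.
  adding-u : ∀ u {P : Fin m → Set} (P? : ∀ x → Dec (P x)) → (∀ x → f x Fin.< f u → P x) → P u →
             # (lower? u) < # P?
  adding-u u P? lower⇒P Pu = ≤-trans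
    (≤-trans (≤-reflexive (+-comm 1 _)) (+-monoʳ-≤ _ (∃⇒#-positive (Finₚ._≟ u) (u , refl))))
    (#-disjoint (lower? u) (Finₚ._≟ u) P? lower⇒P (λ { _ refl → Pu })
      λ { _ fu<fu refl → Finₚ.<-irrefl refl fu<fu })

  bounded : ∀ u → # (lower? u) < m
  bounded u = ≤-trans (adding-u u (λ _ → yes tt) (λ _ _ → tt) tt) (#≤n {m} (λ _ → yes tt))

  rank : Fin m → Fin m
  rank u = Fin.fromℕ< (bounded u)

  rank-mono : ∀ {u v} → f u Fin.< f v → rank u Fin.< rank v
  rank-mono {u} {v} fu<fv = subst₂ _<_
    (sym (Finₚ.toℕ-fromℕ< (bounded u))) (sym (Finₚ.toℕ-fromℕ< (bounded v)))
    (adding-u u (lower? v) (λ _ fx<fu → Finₚ.<-trans fx<fu fu<fv) fu<fv)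

  rank-reflects : ∀ u v → rank u Fin.< rank v → f u Fin.< f v
  rank-reflects u v r< with Finₚ.<-cmp (f u) (f v)
  ... | tri< fu<fv _ _ = fu<fv
  ... | tri≈ _ fu≡fv _ = contradiction r< (Finₚ.<-irrefl (cong rank (f-inj fu≡fv)))
  ... | tri> _ _ fv<fu = contradiction r< (Finₚ.<-asym (rank-mono fv<fu))

  rank-inj : Injective _≡_ _≡_ rank
  rank-inj {u} {v} r≡ with Finₚ.<-cmp (f u) (f v)
  ... | tri< fu<fv _ _ = contradiction (rank-mono fu<fv) (Finₚ.<-irrefl r≡)
  ... | tri≈ _ fu≡fv _ = f-inj fu≡fv
  ... | tri> _ _ fv<fu = contradiction (rank-mono fv<fu) (Finₚ.<-irrefl (sym r≡))

  unrank : Fin m → Fin m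
  unrank y = proj₁ (injective⇒surjective rank rank-inj y)

  rank-unrank : ∀ y → rank (unrank y) ≡ y
  rank-unrank y = proj₂ (injective⇒surjective rank rank-inj y)

  unrank-rank : ∀ x → unrank (rank x) ≡ x
  unrank-rank x = rank-inj (rank-unrank (rank x))

-- Large girth gives a forest

path⇒Walk : ∀ {n} {R : Fin n → Fin n → Set} k (c : Fin (suc k) → Fin n) →
            (∀ i → R (c (inject₁ i)) (c (suc i))) → Walk R k (c zero) (c (fromℕ k))
path⇒Walk zero    c r = stop
path⇒Walk (suc k) c r = step (r zero) (path⇒Walk k (c ∘ suc) (r ∘ suc))

-- Number `H` in the order of the images under `f`. A backedge then maps to a downward arc, hence to
-- an edge of `N`. A cycle of backedges has at most `m` vertices, so without its closing edge it
-- maps to a walk of length less than `m` that avoids the closing edge.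
LargeGirth⇒forest : ∀ {m n} (H : Tournament m) (N : Nbhd n) g (N-sym : Symm N) → LargeGirth g N → m ≤ g →
  (f : Fin m → Fin n) → Preserves H (backTournament N N-sym) f →
  ∃ λ (σ : Numbering H) → IsForest (backedgeGraph H σ)
LargeGirth⇒forest {m} H N g N-sym girth m≤g f pres = σ , no-cycle
  where
  f-inj = Preserves⇒injective H (backTournament N N-sym) f pres
  σ = proj₁ (orderNumbering f f-inj)
  open Graph (backedgeGraph H σ) using (Adj)

  edge : ∀ {u v} → (σ ⟨$⟩ˡ u) Fin.< (σ ⟨$⟩ˡ v) → Tournament._⟶_ H v u → f u ∈ N (f v)
  edge {u} {v} u<v v⟶u with pres v u v⟶u
  ... | inj₁ (fv<fu , _) = contradiction fv<fu (Finₚ.<-asym (proj₂ (orderNumbering f f-inj) u v u<v))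
  ... | inj₂ (_ , fu∈)   = fu∈

  Adj⇒∈ : ∀ u v → Adj u v → f v ∈ N (f u)
  Adj⇒∈ u v (inj₁ (u<v , v⟶u)) = N-sym (edge u<v v⟶u)
  Adj⇒∈ u v (inj₂ (v<u , u⟶v)) = edge v<u u⟶v

  no-cycle : IsForest (backedgeGraph H σ)
  no-cycle cycle = girth (N-sym (Adj⇒∈ _ _ closing))
    (Walk-weaken (≤-trans (n≤1+n k) (≤-trans (Finₚ.injective⇒≤ distinct) m≤g))
      (path⇒Walk k (f ∘ c) avoiding))
    where
    open Cycle cycle
    avoiding : ∀ i → Avoiding N (f (c zero)) (f (c (fromℕ k))) (f (c (inject₁ i))) (f (c (suc i)))
    avoiding i = Adj⇒∈ _ _ (adjacent i) ,
      -- A path edge equal to the closing edge in the same direction would be both first and last,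
      -- forcing `k = 1`; in the opposite direction it would have to start at the last vertex.
      (λ { (p , q) → not-closing (distinct (f-inj p)) (distinct (f-inj q)) }) ,
      (λ { (p , _) → Finₚ.fromℕ≢inject₁ (sym (distinct (f-inj p))) })
      where
      not-closing : inject₁ i ≡ zero → suc i ≡ fromℕ k → ⊥
      not-closing i≡0 1+i≡k = contradiction 2≤k (<⇒≱ (s≤s (≤-reflexive (begin
        k              ≡⟨ sym (Finₚ.toℕ-fromℕ k) ⟩
        toℕ (fromℕ k)  ≡⟨ cong toℕ (sym 1+i≡k) ⟩
        suc (toℕ i)    ≡⟨ cong suc (trans (sym (Finₚ.toℕ-inject₁ i)) (cong toℕ i≡0)) ⟩
        1              ∎))))
        where open ≡-Reasoning

-- The constant of the strong EH-property and the conclusion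

positive-ratio : ∀ c → 0ℚ ℚ.< c → ∃ λ b → NonZero b ×
  (∀ n o → c ℚ.* (ℤ.+ n ℚ./ 1) ℚ.≤ ℤ.+ o ℚ./ 1 → n ≤ o * b)
positive-ratio (mkℚ (ℤ.+ zero) _ _)   (ℚ.*<* (+<+ ()))
positive-ratio (mkℚ -[1+ _ ] _ _) (ℚ.*<* ())
-- The denominator of `c` suffices: clearing it gives `suc a * n ≤ o * suc b-1`, and the numerator
-- is at least 1.
positive-ratio c@(mkℚ (ℤ.+ suc a) b-1 _) _ = suc b-1 , _ , bound
  where
  bound : ∀ n o → c ℚ.* (ℤ.+ n ℚ./ 1) ℚ.≤ ℤ.+ o ℚ./ 1 → n ≤ o * suc b-1
  bound n o c*n≤o = ≤-trans (m≤n*m n (suc a)) (ℤₚ.drop‿+≤+ (subst₂ ℤ._≤_ lhs rhs (ℚᵘₚ.drop-*≤* c*n≤oᵘ)))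
    where
    c*n≤oᵘ : mkℚᵘ (ℤ.+ suc a) b-1 ℚᵘ.* mkℚᵘ (ℤ.+ n) 0 ℚᵘ.≤ mkℚᵘ (ℤ.+ o) 0
    c*n≤oᵘ = begin
      mkℚᵘ (ℤ.+ suc a) b-1 ℚᵘ.* mkℚᵘ (ℤ.+ n) 0     ≃⟨ ℚᵘₚ.*-congˡ {mkℚᵘ (ℤ.+ suc a) b-1} (ℚᵘₚ.≃-sym (ℚₚ.toℚᵘ-fromℚᵘ (mkℚᵘ (ℤ.+ n) 0))) ⟩
      ℚ.toℚᵘ c ℚᵘ.* ℚ.toℚᵘ (ℤ.+ n ℚ./ 1)         ≃⟨ ℚᵘₚ.≃-sym (ℚₚ.toℚᵘ-homo-* c (ℤ.+ n ℚ./ 1)) ⟩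
      ℚ.toℚᵘ (c ℚ.* (ℤ.+ n ℚ./ 1))               ≤⟨ ℚₚ.toℚᵘ-mono-≤ c*n≤o ⟩
      ℚ.toℚᵘ (ℤ.+ o ℚ./ 1)                       ≃⟨ ℚₚ.toℚᵘ-fromℚᵘ (mkℚᵘ (ℤ.+ o) 0) ⟩
      mkℚᵘ (ℤ.+ o) 0                             ∎
      where open ℚᵘₚ.≤-Reasoning

    lhs : (ℤ.+ suc a ℤ.* ℤ.+ n) ℤ.* ℤ.+ 1 ≡ ℤ.+ (suc a * n)
    lhs = trans (ℤₚ.*-identityʳ _) (sym (ℤₚ.pos-* (suc a) n))

    rhs : ℤ.+ o ℤ.* ℤ.+ (suc b-1 * 1) ≡ ℤ.+ (o * suc b-1)
    rhs = trans (sym (ℤₚ.pos-* o (suc b-1 * 1))) (cong (λ d → ℤ.+ (o * d)) (*-identityʳ (suc b-1)))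

mainTheorem1 : ∀ {n : ℕ} (H : Tournament n) → StrongEH H →
    ∃ λ (σ : Numbering H) → IsForest (backedgeGraph H σ)
mainTheorem1 {m} H (c , 0<c , purePairs) = scale (positive-ratio c 0<c)
  where
  Goal : Set
  Goal = ∃ λ (σ : Numbering H) → IsForest (backedgeGraph H σ)

  embed : ∀ b → .{{NonZero b}} → (∀ n o → c ℚ.* (ℤ.+ n ℚ./ 1) ℚ.≤ ℤ.+ o ℚ./ 1 → n ≤ o * b) →
          (∃ λ w → NonZero w × ∃ λ (N : Nbhd (6 * b * w)) →
             Symm N × LargeGirth (m + 3) N × (∀ x → ¬ Bad N (3 * w) x)) → Goal
  embed b@(suc _) c-ratio (w , w≢0 , N , N-sym , girth , no-bad) = decide (preserving? H G)
    where
    G : Tournament (6 * b * w)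
    G = backTournament N N-sym

    1<|G| : 1 < 6 * b * w
    1<|G| = *-mono-≤ {2} {6 * b} {1} {w}
      (≤-trans (s≤s (s≤s z≤n)) (*-monoʳ-≤ 6 {1} {b} (s≤s z≤n))) (>-nonZero⁻¹ w {{w≢0}})

    regroup : ∀ b w → 6 * b * w ≡ 6 * w * b
    regroup = solve-∀

    -- A pure pair has order at least `6 * b * w / b`, which is the size that `noPurePair` excludes.
    large : ∀ o → c ℚ.* (ℤ.+ (6 * b * w) ℚ./ 1) ℚ.≤ ℤ.+ o ℚ./ 1 → 6 * w ≤ o
    large o c|G|≤o = *-cancelʳ-≤ (6 * w) o b (subst (_≤ o * b) (regroup b w) (c-ratio _ o c|G|≤o))

    refute : (Σ (PurePair G) λ P → c ℚ.* (ℤ.+ (6 * b * w) ℚ./ 1) ℚ.≤ ℤ.+ PurePair.order P ℚ./ 1) → ⊥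
    refute (P , c|G|≤order) = noPurePair N (m + 3) w {{w≢0}} N-sym girth (m≤n+m 3 m) no-bad A B pure
        (≤-trans 6w≤ (m⊓n≤m ∣ A ∣ ∣ B ∣)) (≤-trans 6w≤ (m⊓n≤n ∣ A ∣ ∣ B ∣))
      where
      open PurePair P
      6w≤ : 6 * w ≤ order
      6w≤ = large order c|G|≤order

    decide : Dec (∃ λ v → Preserves H G (Vec.lookup v)) → Goal
    decide (yes (v , pres)) = LargeGirth⇒forest H N (m + 3) N-sym girth (m≤m+n m 3) (Vec.lookup v) pres
    decide (no ¬pres) = ⊥-elim (refute
      (purePairs G (λ contains → ¬pres (Contains⇒Preserves H G contains)) 1<|G|))

  scale : (∃ λ b → NonZero b × (∀ n o → c ℚ.* (ℤ.+ n ℚ./ 1) ℚ.≤ ℤ.+ o ℚ./ 1 → n ≤ o * b)) → Goal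
  -- In the girth parameter, `m` serves the cycles of a copy of `H` and 3 the 4-cycle in a pure
  -- pair; `K = 6 * b` makes the number of vertices `6 * b * w`.
  scale (b , b≢0 , c-ratio) =
    embed b {{b≢0}} c-ratio (sparseExpander (m + 3) (6 * b) {{m*n≢0 6 b {{it}} {{b≢0}}}})
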